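{- Let $U,V\subseteq\{0,1\}^n$ be disjoint non-empty sets with $U$ closed upwards (or $V$ closed downwards). Assume that $(\mathbf P_{\mathbf r})_{\mathbf r}$ is a randomized protocol for $KW^m[U,V]$ of size $s$, communication complexity $t$ and error $\epsilon$. Then there is a monotone circuit with a local oracle separating $U$ from $V$ of size $s\,2^{O(t)}$ and locality at most $\epsilon$.
   Context: $O(\cdot)$ hides an absolute constant; orders on $\{0,1\}^n$ are coordinatewise. $KW^m[U,V]$ is the multi-function on $U\times V$ with values in $[n]$ whose valid values at $(u,v)$ are all $i$ with $u_i=1\wedge v_i=0$. Protocols. For a multi-function $R\subseteq U\times V\times I$ consider 4-tuples $\mathbf P=(G,\mathsf{lab},F,S)$: (P1) $G$ is a directed acyclic graph with one source, the root $\emptyset$; (P2) nodes of out-degree $0$ (leaves) are labelled by $\mathsf{lab}$ by elements of $I$; (P3) $S(u,v,x)$ assigns to a non-leaf node $x$ and $(u,v)\in U\times V$ a node reachable by an edge from $x$; (P4a) for every $(u,v)$, $F(u,v)$ is a set of nodes of $G$ with $\emptyset\in F(u,v)$. Size of $\mathbf P$: number of nodes of $G$. $CC(\mathbf P)$: the minimal $t$ such that for every node $x$ two players, one knowing $u,x$ and the other $v,x$, can decide $x\in F(u,v)$, and compute $S(u,v,x)$, each by exchanging at most $t$ bits. A randomized protocol for $R$ with error $\epsilon>0$ is a random variable $(\mathbf P_{\mathbf r})_{\mathbf r}$ of such 4-tuples such that for every $(u,v)\in U\times V$: (P4b') $\mathrm{Prob}_{\mathbf r}[\exists x,\ x\in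 F_{\mathbf r}(u,v)\wedge S_{\mathbf r}(u,v,x)\notin F_{\mathbf r}(u,v)]\le\epsilon$, and (P4c') $\mathrm{Prob}_{\mathbf r}[\exists\text{ leaf }x\in F_{\mathbf r}(u,v),\ \mathsf{lab}_{\mathbf r}(x)=i\wedge\neg R(u,v,i)]\le\epsilon$. Its size and communication complexity are the maxima over $\mathbf r$. Monotone CLO. A monotone circuit with a local oracle (monotone CLO) separating $U$ from $V$ consists of (1) a monotone Boolean circuit $D(x_1,\dots,x_n,y_1,\dots,y_e)$ and (2) a set of combinatorial rectangles $U_j\times V_j\subseteq U\times V$, $j\le e$ (oracle rectangles), such that (3) for all monotone Boolean functions $f_j:\{0,1\}^n\to\{0,1\}$, $j\le e$, with $f_j(U_j)\subseteq\{1\}$ and $f_j(V_j)\subseteq\{0\}$, the function $C(\overline x):=D(\overline x,f_1(\overline x),\dots,f_e(\overline x))$ satisfies $C(U)=\{1\}$ and $C(V)=\{0\}$. Its size is the size (number of nodes) of $D$ and its locality is $|\bigcup_{j\le e}U_j\times V_j|/|U\times V|$.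
   Formalization: Error ε here bounds the probability that (P4b') or (P4c') fails, jointly; with the two bounded separately the lemma is false (U={1^n}, V the points with one 0, ε=1/2), and one gets locality at most 2ε. The size bound 2^{O(t)} is read as 2^{c·max(t,1)}. -}

module Defs where

open import Algebra.Bundles using (CommutativeRing)
import Algebra.Definitions.RawMonoid as RawMonoidDefs
open import Data.Bool.Base as Bool using (Bool; true; false; T; _∧_; _∨_; if_then_else_)
import Data.Bool.Properties as Boolₚ
open import Data.Fin.Base using (Fin; zero; suc)
open import Data.Fin.Properties using (any?; all?)
open import Data.List.Base as List using (List; length; filterᵇ; cartesianProduct)
open import Data.Nat.Base as ℕ using (ℕ; zero; suc)
open import Data.Product.Base using (Σ; Σ-syntax; ∃; ∃-syntax; _×_; _,_)
open import Data.Refinement using (Refinement; Refinement-syntax; value)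
open import Data.Sum.Base using (_⊎_)
open import Data.Vec.Base as Vec using (Vec; []; _∷_; lookup)
open import Data.Vec.Relation.Binary.Pointwise.Inductive using (Pointwise)
open import Function.Bundles using (_⇔_)
open import Level using (Level; 0ℓ) renaming (suc to lsuc; _⊔_ to _⊔ˡ_)
open import Relation.Binary.Construct.Closure.Transitive using (TransClosure)
open import Relation.Binary.PropositionalEquality using (_≡_)
open import Relation.Binary.Structures using (IsTotalOrder)
open import Relation.Nullary using (¬_; Dec; yes; no)
open import Relation.Nullary.Decidable using (does; T?; ¬?; _×-dec_; _⊎-dec_)
open import Relation.Unary using (Pred; Decidable)

-- Probabilities and errors are real numbers in the source.  They are taken in
-- an arbitrary ordered field instead, of which the (classical) reals are an
-- instance.

record OrderedField (c ℓ₁ ℓ₂ : Level) : Set (lsuc (c ⊔ˡ ℓ₁ ⊔ˡ ℓ₂)) where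
  field
    commutativeRing : CommutativeRing c ℓ₁
  open CommutativeRing commutativeRing public
  infix  4 _≤_ _<_
  infixl 7 _/_
  infix  8 _⁻¹
  field
    _≤_          : Carrier → Carrier → Set ℓ₂
    isTotalOrder : IsTotalOrder _≈_ _≤_
    +-monoˡ-≤    : ∀ {x y} z → x ≤ y → x + z ≤ y + z
    *-nonneg     : ∀ {x y} → 0# ≤ x → 0# ≤ y → 0# ≤ x * y
    0≉1          : ¬ (0# ≈ 1#)
    -- total, with an unspecified value at 0#
    _⁻¹          : Carrier → Carrier
    ⁻¹-inverse   : ∀ x → ¬ (x ≈ 0#) → x * x ⁻¹ ≈ 1#

  _<_ : Carrier → Carrier → Set (ℓ₁ ⊔ˡ ℓ₂)
  x < y = x ≤ y × ¬ (x ≈ y)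

  _/_ : Carrier → Carrier → Carrier
  x / y = x * y ⁻¹

  fromℕ : ℕ → Carrier
  fromℕ m = RawMonoidDefs._×_ +-rawMonoid m 1#

  sum : ∀ {m} → (Fin m → Carrier) → Carrier
  sum = RawMonoidDefs.sum +-rawMonoid

-- Subsets of {0,1}ⁿ are given by characteristic functions.

Cube : ℕ → Set
Cube n = Vec Bool n

_≤ᶜ_ : ∀ {n} → Cube n → Cube n → Set
_≤ᶜ_ = Pointwise Bool._≤_

CubeSet : ℕ → Set
CubeSet n = Cube n → Bool

infix 4 _∈_
_∈_ : ∀ {n} → Cube n → CubeSet n → Set
x ∈ U = T (U x)

_⊆_ : ∀ {n} → CubeSet n → CubeSet n → Set
U ⊆ V = ∀ x → x ∈ U → x ∈ V

Elem : ∀ {n} → CubeSet n → Set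
Elem {n} U = [ x ∈ Cube n ∣ T (U x) ]

Nonempty : ∀ {n} → CubeSet n → Set
Nonempty U = ∃[ x ] x ∈ U

Disjoint : ∀ {n} → CubeSet n → CubeSet n → Set
Disjoint U V = ∀ x → x ∈ U → ¬ (x ∈ V)

UpClosed : ∀ {n} → CubeSet n → Set
UpClosed U = ∀ x y → x ≤ᶜ y → x ∈ U → y ∈ U

DownClosed : ∀ {n} → CubeSet n → Set
DownClosed V = ∀ x y → x ≤ᶜ y → y ∈ V → x ∈ V

Monotone : ∀ {n} → (Cube n → Bool) → Set
Monotone f = ∀ x y → x ≤ᶜ y → f x Bool.≤ f y

allCube : ∀ n → List (Cube n)
allCube zero    = List.[ [] ]
allCube (suc n) = List.map (false ∷_) (allCube n) List.++ List.map (true ∷_) (allCube n)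

countPairs : ∀ {n} → (Cube n → Cube n → Bool) → ℕ
countPairs {n} p =
  length (filterᵇ (λ (u , v) → p u v) (cartesianProduct (allCube n) (allCube n)))

KWᵐ : ∀ {n} (U V : CubeSet n) → Elem U → Elem V → Fin n → Set
KWᵐ U V u v i = lookup (value u) i ≡ true × lookup (value v) i ≡ false

KWᵐ? : ∀ {n} (U V : CubeSet n) u v i → Dec (KWᵐ U V u v i)
KWᵐ? U V u v i =
  (lookup (value u) i Boolₚ.≟ true) ×-dec (lookup (value v) i Boolₚ.≟ false)

-- Deterministic two-party communication: at an internal node the named player
-- sends one bit depending on that player's own input; both know the result.

data CommTree (X Y Z : Set) : Set where
  output : Z → CommTree X Y Z
  alice  : (X → Bool) → (l r : CommTree X Y Z) → CommTree X Y Z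
  bob    : (Y → Bool) → (l r : CommTree X Y Z) → CommTree X Y Z

run : ∀ {X Y Z} → CommTree X Y Z → X → Y → Z
run (output z)    x y = z
run (alice f l r) x y = if f x then run r x y else run l x y
run (bob g l r)   x y = if g y then run r x y else run l x y

bits : ∀ {X Y Z} → CommTree X Y Z → ℕ
bits (output _)    = 0
bits (alice _ l r) = suc (bits l ℕ.⊔ bits r)
bits (bob _ l r)   = suc (bits l ℕ.⊔ bits r)

ComputableWithin : ∀ {X Y Z : Set} → ℕ → (X → Y → Z) → Set
ComputableWithin {X} {Y} {Z} t h =
  Σ[ π ∈ CommTree X Y Z ] (bits π ℕ.≤ t × ∀ x y → run π x y ≡ h x y)

Σ-dec : {A : Set} {B : .A → Set} → Dec A → ((a : A) → Dec (B a)) → Dec (Σ A (λ a → B a))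
Σ-dec (no ¬a) d = no λ (a , _) → ¬a a
Σ-dec (yes a) d with d a
... | yes b = yes (a , b)
... | no ¬b = no λ (_ , b) → ¬b b

-- The 4-tuples (G , lab , F , S), subject to (P1)-(P3) and (P4a).

record Protocol (X Y I : Set) : Set where
  field
    size : ℕ
    edge : Fin size → Fin size → Bool

  Node : Set
  Node = Fin size

  Edge : Node → Node → Set
  Edge x y = T (edge x y)

  Leaf : Node → Set
  Leaf x = ∀ y → ¬ Edge x y

  field
    acyclic       : ∀ x → ¬ TransClosure Edge x x
    root          : Node
    source⇔root   : ∀ x → (∀ y → ¬ Edge y x) ⇔ x ≡ root
    lab           : ∀ x → .(Leaf x) → I
    S             : X → Y → ∀ x → .(¬ Leaf x) → Node
    S-edge        : ∀ u v x (nl : ¬ Leaf x) → Edge x (S u v x nl)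
    F             : X → Y → Node → Bool
    root∈F        : ∀ u v → T (F u v root)

  leaf? : Decidable Leaf
  leaf? x = all? (λ y → ¬? (T? (edge x y)))

  StepError : X → Y → Set
  StepError u v =
    Σ[ x ∈ Node ] Σ[ nl ∈ ¬ Leaf x ] (T (F u v x) × ¬ T (F u v (S u v x nl)))

  LabelError : (X → Y → I → Set) → X → Y → Set
  LabelError R u v =
    Σ[ x ∈ Node ] Σ[ l ∈ Leaf x ] (T (F u v x) × ¬ R u v (lab x l))

  stepError? : ∀ u v → Dec (StepError u v)
  stepError? u v = any? λ x →
    Σ-dec (¬? (leaf? x)) λ nl → T? (F u v x) ×-dec ¬? (T? (F u v (S u v x nl)))

  labelError? : ∀ {R} → (∀ u v i → Dec (R u v i)) → ∀ u v → Dec (LabelError R u v)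
  labelError? R? u v = any? λ x →
    Σ-dec (leaf? x) λ l → T? (F u v x) ×-dec ¬? (R? u v (lab x l))

  Error : (X → Y → I → Set) → X → Y → Set
  Error R u v = StepError u v ⊎ LabelError R u v

  error? : ∀ {R} → (∀ u v i → Dec (R u v i)) → ∀ u v → Dec (Error R u v)
  error? R? u v = stepError? u v ⊎-dec labelError? R? u v

  CC≤ : ℕ → Set
  CC≤ t = ∀ x → ComputableWithin t (λ u v → F u v x)
              × ((nl : ¬ Leaf x) → ComputableWithin t (λ u v → S u v x nl))

-- A family of protocols indexed by a finite probability space.  The error ε
-- bounds, for each (u , v), the probability that the run condition or the label
-- condition fails; so it bounds each of the two failure probabilities.  Were
-- only the two separate probabilities bounded by ε, circuits of size s 2^O(t)
-- and locality ≤ ε need not exist.  Take U = {1ⁿ}, V the points with exactly one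
-- 0, and a fair choice between a two-node protocol that always makes a step
-- error and a one-node protocol labelled by a fixed coordinate: s = 2, t = 0
-- and both probabilities are ≤ 1/2.  But if the oracle rectangles cover at most
-- half of U × V, then D has to read x_i for at least n/2 many i (take f_j = 0 if
-- U_j is empty, and otherwise f_j = 1 except below points of V_j).

record RandomizedProtocol {c ℓ₁ ℓ₂} (K : OrderedField c ℓ₁ ℓ₂) {X Y I : Set}
         (R : X → Y → I → Set) (R? : ∀ u v i → Dec (R u v i))
         (ε : OrderedField.Carrier K) : Set (c ⊔ˡ ℓ₁ ⊔ˡ ℓ₂) where
  open OrderedField K using (Carrier; _≈_; _≤_; _<_; 0#; 1#; sum)
  field
    outcomes : ℕ
    weight   : Fin outcomes → Carrier
    weight≥0 : ∀ r → 0# ≤ weight r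
    weight-1 : sum weight ≈ 1#
    P        : Fin outcomes → Protocol X Y I

  Prob : {E : Pred (Fin outcomes) 0ℓ} → Decidable E → Carrier
  Prob E? = sum (λ r → if does (E? r) then weight r else 0#)

  field
    ε>0   : 0# < ε
    error : ∀ u v → Prob (λ r → Protocol.error? (P r) R? u v) ≤ ε

  -- Size and communication complexity are maxima over the outcomes; a maximum
  -- is bounded by s iff every value is.  Bounds O(t) are read as c · max(t, 1):
  -- for t = 0 the literal c · t would leave no constant factor at all.
  Size≤ : ℕ → Set
  Size≤ s = ∀ r → Protocol.size (P r) ℕ.≤ s

  CC≤ : ℕ → Set
  CC≤ t = ∀ r → Protocol.CC≤ (P r) t

-- Circuits are straight-line programs; a gate refers to earlier nodes, index
-- zero being the most recent one.  Input nodes count towards the size.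

data Gate (n e k : ℕ) : Set where
  input   : Fin n → Gate n e k
  oracle  : Fin e → Gate n e k
  const   : Bool → Gate n e k
  and or  : Fin k → Fin k → Gate n e k

data Gates (n e : ℕ) : ℕ → Set where
  []  : Gates n e 0
  _▷_ : ∀ {k} → Gates n e k → Gate n e k → Gates n e (suc k)

evalGate : ∀ {n e k} → Gate n e k → Cube n → (Fin e → Bool) → Vec Bool k → Bool
evalGate (input i)  x y w = lookup x i
evalGate (oracle j) x y w = y j
evalGate (const b)  x y w = b
evalGate (and a b)  x y w = lookup w a ∧ lookup w b
evalGate (or a b)   x y w = lookup w a ∨ lookup w b

evalGates : ∀ {n e k} → Gates n e k → Cube n → (Fin e → Bool) → Vec Bool k
evalGates []       x y = []
evalGates (gs ▷ g) x y = evalGate g x y (evalGates gs x y) ∷ evalGates gs x y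

record MonotoneCircuit (n e : ℕ) : Set where
  field
    size  : ℕ
    gates : Gates n e size
    out   : Fin size

  eval : Cube n → (Fin e → Bool) → Bool
  eval x y = lookup (evalGates gates x y) out

record MonotoneCLO {n} (U V : CubeSet n) : Set where
  field
    e     : ℕ
    D     : MonotoneCircuit n e
    Uᵣ Vᵣ : Fin e → CubeSet n
    Uᵣ⊆U  : ∀ j → Uᵣ j ⊆ U
    Vᵣ⊆V  : ∀ j → Vᵣ j ⊆ V
    separates : (f : Fin e → Cube n → Bool) →
      (∀ j → Monotone (f j)) →
      (∀ j u → u ∈ Uᵣ j → f j u ≡ true) →
      (∀ j v → v ∈ Vᵣ j → f j v ≡ false) →
      (∀ u → u ∈ U → MonotoneCircuit.eval D u (λ j → f j u) ≡ true) ×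
      (∀ v → v ∈ V → MonotoneCircuit.eval D v (λ j → f j v) ≡ false)

  size : ℕ
  size = MonotoneCircuit.size D

  covered : Cube n → Cube n → Bool
  covered u v = does (any? λ j → T? (Uᵣ j u ∧ Vᵣ j v))

  locality : ∀ {c ℓ₁ ℓ₂} (K : OrderedField c ℓ₁ ℓ₂) → OrderedField.Carrier K
  locality K = fromℕ (countPairs covered) / fromℕ (countPairs λ u v → U u ∧ V v)
    where open OrderedField K using (fromℕ; _/_)

{-# OPTIONS --safe #-}
module Submission where

-- By averaging, some outcome r errs on at most an ε fraction of U × V.  Fix it.
-- For each node x and each leaf of the communication tree deciding x ∈ F, let
-- A × B be the rectangle of inputs reaching that leaf.  If the leaf accepts, one
-- gate separates A from B: refine the rectangle by the tree for S at x and then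
-- by the tree for y ∈ F, where y = S(u, v, x); reuse the gate of y where y is
-- accepted, and an oracle on the rectangle of step errors where it is rejected.
-- A leaf x labelled i uses the input i, with oracles on the rectangles u_i = 0
-- and v_i = 1 of label errors.  Bits of the first player become disjunctions,
-- those of the second conjunctions.  As the number of oracles is not part of the
-- size, all rectangles consisting of errors are supplied at once.

open import Defs
import Algebra.Properties.Ring as RingProperties
import Algebra.Properties.Semiring.Sum as SemiringSum
open import Data.Bool.Base using (Bool; true; false; T; _∧_; _∨_; not; if_then_else_)
open import Data.Bool.Properties using (T-∧; T-≡; T-not-≡; ∨-zeroʳ; ∧-zeroʳ)
open import Data.Empty using (⊥-elim)
open import Data.Fin.Base using (Fin; zero; suc)
open import Data.Fin.Induction using (spo-noetherian)
import Data.Fin.Properties as Fin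
open import Data.Fin.Subset as Subset using (Subset; ∣_∣; ⁅_⁆; _∪_)
open import Data.Fin.Subset.Induction using (⊃-wellFounded)
open import Data.Fin.Subset.Properties
  using (_∈?_; p⊆p∪q; q⊆p∪q; x∈p∪q⁻; x∈⁅x⁆; x∈⁅y⁆⇒x≡y; p⊂q⇒∣p∣<∣q∣; ∣p∣≤n; ∉⊥)
open import Data.Irrelevant using ([_])
open import Data.List.Base as List
  using (List; []; _∷_; length; filterᵇ; filter; cartesianProduct; cartesianProductWith; allFin)
open import Data.List.Extrema.Nat using (argmin; f[argmin]≤f[xs])
open import Data.List.Membership.Propositional using () renaming (_∈_ to _∈ˡ_)
open import Data.List.Membership.Propositional.Properties
  using (∈-++⁺ˡ; ∈-++⁺ʳ; ∈-map⁺; ∈-cartesianProduct⁺; ∈-cartesianProductWith⁺;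
         ∈-filter⁺; ∈-filter⁻; ∈-length; ∈-lookup; ∈-allFin)
import Data.List.Relation.Binary.Sublist.Propositional as Sublist
import Data.List.Relation.Binary.Sublist.Propositional.Properties as Sublist
import Data.List.Relation.Unary.All as All
import Data.List.Relation.Unary.Any as Any
open import Data.List.Relation.Unary.Any.Properties using (lookup-index)
open import Data.Nat.Base using (ℕ; zero; suc; z≤n; s≤s; _≤_; _+_; _*_; _^_; _⊔_)
open import Data.Product.Base using (Σ-syntax; ∃-syntax; _×_; _,_; proj₁; proj₂)
open import Data.Refinement using (value; _,_)
open import Data.Sum.Base as Sum using (_⊎_; inj₁; inj₂)
open import Data.Unit.Base using (⊤; tt)
open import Data.Vec.Base using (lookup; []; _∷_)
open import Function.Base using (id; _∘_; flip; _$_)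
open import Function.Bundles using (Equivalence; mk⇔)
open import Induction.WellFounded using (WellFounded; Acc; acc; module Subrelation)
open import Relation.Binary.Bundles using (Poset)
import Relation.Binary.Construct.Closure.Transitive as Plus
import Relation.Binary.PropositionalEquality as ≡
import Relation.Binary.Reasoning.PartialOrder as PosetReasoning
open import Relation.Binary.Structures using (IsTotalOrder)
open import Relation.Nullary using (¬_; Dec; yes; no; contradiction)
open import Relation.Nullary.Decidable
  using (T?; ¬?; _×-dec_; decidable-stable; does; does-⇔; dec-true; dec-false; _→-dec_; recompute; map′)

open Equivalence using (to; from)

-- Ordered fields, double counting and averaging.

count : {A : Set} → (A → Bool) → List A → ℕ
count p xs = length (filterᵇ p xs)

module OrderedFieldProperties {a ℓ₁ ℓ₂} (K : OrderedField a ℓ₁ ℓ₂) where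
  open OrderedField K hiding (zero) renaming (_≤_ to _≤ᴷ_; _+_ to _+ᴷ_; _*_ to _*ᴷ_)
  open RingProperties ring using ([y-z]x≈yx-zx; -‿distribˡ-*; -‿distribʳ-*; -‿involutive)
  open SemiringSum semiring using (*-distribʳ-sum; ∑-distrib-+; sum-cong-≋; sum-replicate-zero)
  module ≤ᴷ = IsTotalOrder isTotalOrder
  poset : Poset a ℓ₁ ℓ₂
  poset = record { isPartialOrder = ≤ᴷ.isPartialOrder }
  open PosetReasoning poset

  +-mono-≤ᴷ : ∀ {x y z w} → x ≤ᴷ y → z ≤ᴷ w → x +ᴷ z ≤ᴷ y +ᴷ w
  +-mono-≤ᴷ {x} {y} {z} {w} x≤y z≤w = begin
    x +ᴷ z  ≤⟨ +-monoˡ-≤ z x≤y ⟩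
    y +ᴷ z  ≈⟨ +-comm y z ⟩
    z +ᴷ y  ≤⟨ +-monoˡ-≤ y z≤w ⟩
    w +ᴷ y  ≈⟨ +-comm w y ⟩
    y +ᴷ w  ∎

  sub-nonneg : ∀ {x y} → x ≤ᴷ y → 0# ≤ᴷ y - x
  sub-nonneg {x} {y} x≤y = begin
    0#     ≈⟨ -‿inverseʳ x ⟨
    x - x  ≤⟨ +-monoˡ-≤ (- x) x≤y ⟩
    y - x  ∎

  nonneg-sub : ∀ {x y} → 0# ≤ᴷ y - x → x ≤ᴷ y
  nonneg-sub {x} {y} 0≤ = begin
    x              ≈⟨ +-identityˡ x ⟨
    0# +ᴷ x        ≤⟨ +-monoˡ-≤ x 0≤ ⟩
    (y - x) +ᴷ x   ≈⟨ +-assoc y (- x) x ⟩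
    y +ᴷ (- x +ᴷ x) ≈⟨ +-congˡ (-‿inverseˡ x) ⟩
    y +ᴷ 0#        ≈⟨ +-identityʳ y ⟩
    y              ∎

  *-monoʳ-≤ᴷ : ∀ {x y z} → 0# ≤ᴷ z → x ≤ᴷ y → x *ᴷ z ≤ᴷ y *ᴷ z
  *-monoʳ-≤ᴷ {x} {y} {z} 0≤z x≤y = nonneg-sub (begin
    0#                 ≤⟨ *-nonneg (sub-nonneg x≤y) 0≤z ⟩
    (y - x) *ᴷ z       ≈⟨ [y-z]x≈yx-zx z y x ⟩
    y *ᴷ z - x *ᴷ z    ∎)

  *-monoˡ-≤ᴷ : ∀ {x y z} → 0# ≤ᴷ z → x ≤ᴷ y → z *ᴷ x ≤ᴷ z *ᴷ y
  *-monoˡ-≤ᴷ {x} {y} {z} 0≤z x≤y = begin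
    z *ᴷ x  ≈⟨ *-comm z x ⟩
    x *ᴷ z  ≤⟨ *-monoʳ-≤ᴷ 0≤z x≤y ⟩
    y *ᴷ z  ≈⟨ *-comm y z ⟩
    z *ᴷ y  ∎

  0≤1 : 0# ≤ᴷ 1#
  0≤1 with ≤ᴷ.total 0# 1#
  ... | inj₁ p = p
  ... | inj₂ p = begin
    0#               ≤⟨ *-nonneg 0≤-1 0≤-1 ⟩
    - 1# *ᴷ - 1#     ≈⟨ -‿distribˡ-* 1# (- 1#) ⟨
    - (1# *ᴷ - 1#)   ≈⟨ -‿cong (*-identityˡ (- 1#)) ⟩
    - - 1#           ≈⟨ -‿involutive 1# ⟩
    1#               ∎
    where
    0≤-1 : 0# ≤ᴷ - 1#
    0≤-1 = ≤ᴷ.trans (sub-nonneg p) (≤ᴷ.reflexive (+-identityˡ (- 1#)))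

  fromℕ-mono : ∀ {m k} → m ≤ k → fromℕ m ≤ᴷ fromℕ k
  fromℕ-mono {k = zero} z≤n  = ≤ᴷ.refl
  fromℕ-mono {k = suc k} z≤n = begin
    0#               ≈⟨ +-identityˡ 0# ⟨
    0# +ᴷ 0#         ≤⟨ +-mono-≤ᴷ 0≤1 (fromℕ-mono {k = k} z≤n) ⟩
    1# +ᴷ fromℕ k    ∎
  fromℕ-mono (s≤s m≤k) = +-mono-≤ᴷ ≤ᴷ.refl (fromℕ-mono m≤k)

  1≤fromℕ : ∀ {m} → 1 ≤ m → 1# ≤ᴷ fromℕ m
  1≤fromℕ 1≤m = ≤ᴷ.trans (≤ᴷ.reflexive (sym (+-identityʳ 1#))) (fromℕ-mono 1≤m)

  -- From `1# ≤ y` follow both that `y` is nonzero and that `y ⁻¹` is nonnegative: a nonpositive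
  -- inverse would give `1# ≤ 0#`.
  /-≤ : ∀ {x y z} → 1# ≤ᴷ y → x ≤ᴷ z *ᴷ y → x / y ≤ᴷ z
  /-≤ {x} {y} {z} 1≤y x≤zy = begin
    x *ᴷ y ⁻¹          ≤⟨ *-monoʳ-≤ᴷ y⁻¹≥0 x≤zy ⟩
    z *ᴷ y *ᴷ y ⁻¹     ≈⟨ *-assoc z y (y ⁻¹) ⟩
    z *ᴷ (y *ᴷ y ⁻¹)   ≈⟨ *-congˡ yy⁻¹≈1 ⟩
    z *ᴷ 1#            ≈⟨ *-identityʳ z ⟩
    z                  ∎
    where
    0≤y : 0# ≤ᴷ y
    0≤y = ≤ᴷ.trans 0≤1 1≤y
    yy⁻¹≈1 : y *ᴷ y ⁻¹ ≈ 1#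
    yy⁻¹≈1 = ⁻¹-inverse y λ y≈0 → 0≉1 (≤ᴷ.antisym 0≤1 (≤ᴷ.trans 1≤y (≤ᴷ.reflexive y≈0)))
    y⁻¹≥0 : 0# ≤ᴷ y ⁻¹
    y⁻¹≥0 with ≤ᴷ.total 0# (y ⁻¹)
    ... | inj₁ p = p
    ... | inj₂ p = ⊥-elim (0≉1 (≤ᴷ.antisym 0≤1 (begin
      1#          ≈⟨ yy⁻¹≈1 ⟨
      y *ᴷ y ⁻¹   ≤⟨ *-monoˡ-≤ᴷ 0≤y p ⟩
      y *ᴷ 0#     ≈⟨ zeroʳ y ⟩
      0#          ∎)))

  sum-mono : ∀ {m} {f g : Fin m → Carrier} → (∀ i → f i ≤ᴷ g i) → sum f ≤ᴷ sum g
  sum-mono {zero}  h = ≤ᴷ.refl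
  sum-mono {suc m} h = +-mono-≤ᴷ (h zero) (sum-mono (h ∘ suc))

  -- The same conditional as in the summands of `Prob`, so that the error bound applies without
  -- conversion.
  [_]·_ : Bool → Carrier → Carrier
  [ b ]· x = if b then x else 0#

  sum-[]·-cong : ∀ {m} (w : Fin m → Carrier) {b b′ : Fin m → Bool} → (∀ r → b r ≡.≡ b′ r) →
    sum (λ r → [ b r ]· w r) ≈ sum (λ r → [ b′ r ]· w r)
  sum-[]·-cong w b≡b′ = sum-cong-≋ λ r → reflexive (≡.cong ([_]· w r) (b≡b′ r))

  sum-[]·-≤ : ∀ {m} (w : Fin m → Carrier) {b : Fin m → Bool} c {ε} →
    (T c → sum (λ r → [ b r ]· w r) ≤ᴷ ε) → (¬ T c → ∀ r → b r ≡.≡ false) →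
    sum (λ r → [ b r ]· w r) ≤ᴷ [ c ]· ε
  sum-[]·-≤ w true  h _ = h tt
  sum-[]·-≤ {m} w false _ h = ≤ᴷ.reflexive (trans (sum-[]·-cong w (h id)) (sum-replicate-zero m))

  *-count-∷ : ∀ {A : Set} x (p : A → Bool) z zs →
    x *ᴷ fromℕ (count p (z ∷ zs)) ≈ [ p z ]· x +ᴷ x *ᴷ fromℕ (count p zs)
  *-count-∷ x p z zs with p z
  ... | true  = trans (distribˡ x 1# _) (+-congʳ (*-identityʳ x))
  ... | false = sym (+-identityˡ _)

  -- Both sides count pairs (r , z) weighted by w; the left one groups them by r, the hypothesis by z.
  double-count : ∀ {A : Set} {m} (w : Fin m → Carrier) (p : Fin m → A → Bool) (q : A → Bool) ε →
    (∀ z → sum (λ r → [ p r z ]· w r) ≤ᴷ [ q z ]· ε) →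
    ∀ zs → sum (λ r → w r *ᴷ fromℕ (count (p r) zs)) ≤ᴷ ε *ᴷ fromℕ (count q zs)
  double-count {m = m} w p q ε h [] = begin
    sum (λ r → w r *ᴷ 0#)  ≈⟨ sum-cong-≋ (λ r → zeroʳ (w r)) ⟩
    sum (λ (_ : Fin m) → 0#)  ≈⟨ sum-replicate-zero m ⟩
    0#                     ≈⟨ zeroʳ ε ⟨
    ε *ᴷ 0#                ∎
  double-count w p q ε h (z ∷ zs) = begin
    sum (λ r → w r *ᴷ fromℕ (count (p r) (z ∷ zs)))
      ≈⟨ sum-cong-≋ (λ r → *-count-∷ (w r) (p r) z zs) ⟩
    sum (λ r → [ p r z ]· w r +ᴷ w r *ᴷ fromℕ (count (p r) zs))
      ≈⟨ ∑-distrib-+ (λ r → [ p r z ]· w r) (λ r → w r *ᴷ fromℕ (count (p r) zs)) ⟩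
    sum (λ r → [ p r z ]· w r) +ᴷ sum (λ r → w r *ᴷ fromℕ (count (p r) zs))
      ≤⟨ +-mono-≤ᴷ (h z) (double-count w p q ε h zs) ⟩
    [ q z ]· ε +ᴷ ε *ᴷ fromℕ (count q zs)
      ≈⟨ *-count-∷ ε q z zs ⟨
    ε *ᴷ fromℕ (count q (z ∷ zs))
      ∎

  -- The outcome with the smallest count does at least as well as the weighted mean of the counts,
  -- which `double-count` bounds.
  averaging : ∀ {A : Set} {m} (w : Fin m → Carrier) (p : Fin m → A → Bool) (q : A → Bool) ε →
    (∀ r → 0# ≤ᴷ w r) → sum w ≈ 1# → (∀ z → sum (λ r → [ p r z ]· w r) ≤ᴷ [ q z ]· ε) →
    ∀ zs → ∃[ r ] fromℕ (count (p r) zs) ≤ᴷ ε *ᴷ fromℕ (count q zs)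
  averaging {m = zero}  w p q ε w≥0 Σw≈1 h zs = ⊥-elim (0≉1 Σw≈1)
  averaging {m = suc m} w p q ε w≥0 Σw≈1 h zs = r , (begin
    fromℕ (N r)                      ≈⟨ *-identityˡ _ ⟨
    1# *ᴷ fromℕ (N r)                ≈⟨ *-congʳ Σw≈1 ⟨
    sum w *ᴷ fromℕ (N r)             ≈⟨ *-distribʳ-sum (fromℕ (N r)) w ⟩
    sum (λ i → w i *ᴷ fromℕ (N r))   ≤⟨ sum-mono (λ i → *-monoˡ-≤ᴷ (w≥0 i) (fromℕ-mono (r-min i))) ⟩
    sum (λ i → w i *ᴷ fromℕ (N i))   ≤⟨ double-count w p q ε h zs ⟩
    ε *ᴷ fromℕ (count q zs)          ∎)
    where
    N : Fin (suc m) → ℕ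
    N i = count (p i) zs
    r : Fin (suc m)
    r = argmin N zero (allFin (suc m))
    r-min : ∀ i → N r ≤ N i
    r-min i = All.lookup (f[argmin]≤f[xs] {f = N} zero (allFin (suc m))) (∈-allFin i)

open import Data.Nat.Properties
open import Relation.Binary.PropositionalEquality
  using (_≡_; refl; sym; trans; cong; cong₂; subst; resp₂; isEquivalence)

-- Extensions of straight-line programs and compilation of formulas.

Valuation : ℕ → ℕ → Set
Valuation n e = Cube n → (Fin e → Bool) → Bool

gateValue : ∀ {n e k} → Gates n e k → Fin k → Valuation n e
gateValue gs i x y = lookup (evalGates gs x y) i

infix 4 _⊑_
data _⊑_ {n e k} (gs : Gates n e k) : ∀ {k′} → Gates n e k′ → Set where
  ⊑-refl : gs ⊑ gs
  ⊑-▷    : ∀ {k′} {gs′ : Gates n e k′} {g} → gs ⊑ gs′ → gs ⊑ gs′ ▷ g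

⊑-trans : ∀ {n e k₁ k₂ k₃} {gs₁ : Gates n e k₁} {gs₂ : Gates n e k₂} {gs₃ : Gates n e k₃} →
          gs₁ ⊑ gs₂ → gs₂ ⊑ gs₃ → gs₁ ⊑ gs₃
⊑-trans p ⊑-refl  = p
⊑-trans p (⊑-▷ q) = ⊑-▷ (⊑-trans p q)

embed : ∀ {n e k k′} {gs : Gates n e k} {gs′ : Gates n e k′} → gs ⊑ gs′ → Fin k → Fin k′
embed ⊑-refl  i = i
embed (⊑-▷ p) i = suc (embed p i)

gateValue-embed : ∀ {n e k k′} {gs : Gates n e k} {gs′ : Gates n e k′} (p : gs ⊑ gs′) i x y →
                  gateValue gs′ (embed p i) x y ≡ gateValue gs i x y
gateValue-embed ⊑-refl  i x y = refl
gateValue-embed (⊑-▷ p) i x y = gateValue-embed p i x y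

infixr 6 _∧ᶠ_
infixr 5 _∨ᶠ_
-- Atoms `node i` refer to gates already present, so what was built for one protocol node is shared
-- by all its predecessors.
data Formula (n e k : ℕ) : Set where
  node      : Fin k → Formula n e k
  input     : Fin n → Formula n e k
  oracle    : Fin e → Formula n e k
  _∧ᶠ_ _∨ᶠ_ : Formula n e k → Formula n e k → Formula n e k

formulaValue : ∀ {n e k} → Gates n e k → Formula n e k → Valuation n e
formulaValue gs (node i)   x y = gateValue gs i x y
formulaValue gs (input i)  x y = lookup x i
formulaValue gs (oracle j) x y = y j
formulaValue gs (φ ∧ᶠ ψ)   x y = formulaValue gs φ x y ∧ formulaValue gs ψ x y
formulaValue gs (φ ∨ᶠ ψ)   x y = formulaValue gs φ x y ∨ formulaValue gs ψ x y

-- One more than the number of symbols, which makes the weight additive.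
weight : ∀ {n e k} → Formula n e k → ℕ
weight (φ ∧ᶠ ψ) = weight φ + weight ψ
weight (φ ∨ᶠ ψ) = weight φ + weight ψ
weight _        = 2

-- The successor in `bound` means that weight `w` adds at most `w - 1` gates. In `compileBin` one of
-- the two units saved by the operands pays for the connective.
record Compiled {n e k} (gs : Gates n e k) (h : Valuation n e) (w : ℕ) : Set where
  field
    {size}  : ℕ
    gates   : Gates n e size
    ext     : gs ⊑ gates
    out     : Fin size
    bound   : suc size ≤ k + w
    correct : ∀ x y → gateValue gates out x y ≡ h x y

private
  compileAtom : ∀ {n e k} {gs : Gates n e k} {h} (g : Gate n e k) →
                (∀ x y → evalGate g x y (evalGates gs x y) ≡ h x y) → Compiled gs h 2
  compileAtom {k = k} {gs} g correct = record
    { gates   = gs ▷ g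
    ; ext     = ⊑-▷ ⊑-refl
    ; out     = zero
    ; bound   = ≤-reflexive (+-comm 2 k)
    ; correct = correct
    }

  compileBin : ∀ {n e k w w′} {gs : Gates n e k} {h h′} (g : ∀ {k} → Fin k → Fin k → Gate n e k)
               (_∙_ : Bool → Bool → Bool) →
               (∀ {k} (gs : Gates n e k) i j x y → evalGate (g i j) x y (evalGates gs x y) ≡ gateValue gs i x y ∙ gateValue gs j x y) →
               (c : Compiled gs h w) → Compiled (Compiled.gates c) h′ w′ →
               Compiled gs (λ x y → h x y ∙ h′ x y) (w + w′)
  compileBin {k = k} {w} {w′} g _∙_ g-correct c c′ = record
    { gates   = C′.gates ▷ g (embed C′.ext C.out) C′.out
    ; ext     = ⊑-▷ (⊑-trans C.ext C′.ext)
    ; out     = zero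
    ; bound   = begin
        suc (suc C′.size)  ≤⟨ s≤s C′.bound ⟩
        suc C.size + w′    ≤⟨ +-monoˡ-≤ w′ C.bound ⟩
        (k + w) + w′       ≡⟨ +-assoc k w w′ ⟩
        k + (w + w′)       ∎
    ; correct = λ x y → trans (g-correct C′.gates _ _ x y)
        (cong₂ _∙_ (trans (gateValue-embed C′.ext C.out x y) (C.correct x y)) (C′.correct x y))
    }
    where
    module C  = Compiled c
    module C′ = Compiled c′
    open ≤-Reasoning

-- The atoms of `φ` refer to `gs`, while `gs′` is the program being extended. Keeping the two apart
-- lets the second operand be compiled after the gates of the first.
compile : ∀ {n e k k′} {gs : Gates n e k} {gs′ : Gates n e k′} (φ : Formula n e k) →
          gs ⊑ gs′ → Compiled gs′ (formulaValue gs φ) (weight φ)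
compile {k′ = k′} {gs} {gs′} (node i) p = record
  { gates   = gs′
  ; ext     = ⊑-refl
  ; out     = embed p i
  ; bound   = ≤-trans (n≤1+n _) (≤-reflexive (+-comm 2 k′))
  ; correct = gateValue-embed p i
  }
compile (input i)  p = compileAtom (input i) λ _ _ → refl
compile (oracle j) p = compileAtom (oracle j) λ _ _ → refl
compile (φ ∧ᶠ ψ)   p = compileBin and _∧_ (λ _ _ _ _ _ → refl) c (compile ψ (⊑-trans p (Compiled.ext c)))
  where c = compile φ p
compile (φ ∨ᶠ ψ)   p = compileBin or _∨_ (λ _ _ _ _ _ → refl) c (compile ψ (⊑-trans p (Compiled.ext c)))
  where c = compile φ p

-- Rectangles at the leaves of communication trees.

infix 4 _⊆ᵇ_
_⊆ᵇ_ : {X : Set} → (X → Bool) → (X → Bool) → Set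
A ⊆ᵇ A′ = ∀ x → T (A x) → T (A′ x)

infixl 7 _∩ᵇ_ _∖ᵇ_
_∩ᵇ_ _∖ᵇ_ : {X : Set} → (X → Bool) → (X → Bool) → X → Bool
(A ∩ᵇ f) x = A x ∧ f x
(A ∖ᵇ f) x = A x ∧ not (f x)

full : {X : Set} → X → Bool
full _ = true

∩ᵇ-⊆ : {X : Set} (A f : X → Bool) → A ∩ᵇ f ⊆ᵇ A
∩ᵇ-⊆ A f x = proj₁ ∘ to T-∧

∩ᵇ-monoˡ : {X : Set} {A A′ : X → Bool} (f : X → Bool) → A ⊆ᵇ A′ → A ∩ᵇ f ⊆ᵇ A′ ∩ᵇ f
∩ᵇ-monoˡ f s x p = let (a , b) = to T-∧ p in from T-∧ (s x a , b)

∩ᵇ-true : {X : Set} (A f : X → Bool) → ∀ x → T ((A ∩ᵇ f) x) → f x ≡ true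
∩ᵇ-true A f x = to T-≡ ∘ proj₂ ∘ to (T-∧ {A x})

∖ᵇ-false : {X : Set} (A f : X → Bool) → ∀ x → T ((A ∖ᵇ f) x) → f x ≡ false
∖ᵇ-false A f x = to T-not-≡ ∘ proj₂ ∘ to (T-∧ {A x})

∈∖∪∩ : {X : Set} (A f : X → Bool) → ∀ x → T (A x) → T ((A ∖ᵇ f) x) ⊎ T ((A ∩ᵇ f) x)
∈∖∪∩ A f x a with f x
... | false = inj₁ (from T-∧ (a , tt))
... | true  = inj₂ (from T-∧ (a , tt))

∨-true : ∀ {a b} → a ≡ true ⊎ b ≡ true → a ∨ b ≡ true
∨-true (inj₁ refl) = refl
∨-true (inj₂ refl) = ∨-zeroʳ _

∧-false : ∀ {a b} → a ≡ false ⊎ b ≡ false → a ∧ b ≡ false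
∧-false (inj₁ refl) = refl
∧-false (inj₂ refl) = ∧-zeroʳ _

RectPred : Set → Set → Set → Set₁
RectPred X Y Z = (X → Bool) → (Y → Bool) → Z → Set

-- Q holds at every leaf of the tree, at the rectangle of those inputs from
-- A × B that reach the leaf and at the leaf's output.
Leaves : ∀ {X Y Z} → RectPred X Y Z → (X → Bool) → (Y → Bool) → CommTree X Y Z → Set
Leaves Q A B (output z)    = Q A B z
Leaves Q A B (alice f l r) = Leaves Q (A ∖ᵇ f) B l × Leaves Q (A ∩ᵇ f) B r
Leaves Q A B (bob g l r)   = Leaves Q A (B ∖ᵇ g) l × Leaves Q A (B ∩ᵇ g) r

-- Shrinking the rectangle shrinks every leaf rectangle, so facts known at the leaves can be
-- transported. The hypothesis on leaves may also use that the new leaf rectangle lies in `A′` ×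
-- `B′` and that the tree outputs `z` on it.
Leaves-restrict : ∀ {X Y Z} {Q Q′ : RectPred X Y Z} π {A A′ B B′} → A′ ⊆ᵇ A → B′ ⊆ᵇ B →
  (∀ {A₁ A₁′ B₁ B₁′ z} → A₁′ ⊆ᵇ A₁ → B₁′ ⊆ᵇ B₁ → A₁′ ⊆ᵇ A′ → B₁′ ⊆ᵇ B′ →
   (∀ u v → T (A₁′ u) → T (B₁′ v) → run π u v ≡ z) → Q A₁ B₁ z → Q′ A₁′ B₁′ z) →
  Leaves Q A B π → Leaves Q′ A′ B′ π
Leaves-restrict (output z) sA sB h q =
  h sA sB (λ _ → id) (λ _ → id) (λ _ _ _ _ → refl) q
Leaves-restrict (alice f l r) {A′ = A′} sA sB h (ql , qr) =
    -- `A ∖ᵇ f` unfolds to `A ∩ᵇ (not ∘ f)`, so the lemmas on intersections serve both branches.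
    Leaves-restrict l (∩ᵇ-monoˡ (not ∘ f) sA) sB
      (λ {_} {A₁′} s₁ s₂ s₃ s₄ e → h s₁ s₂ (λ u → ∩ᵇ-⊆ A′ (not ∘ f) u ∘ s₃ u) s₄
        (λ u v a b → trans (cong (λ c → if c then _ else _) (∖ᵇ-false A′ f u (s₃ u a))) (e u v a b))) ql
  , Leaves-restrict r (∩ᵇ-monoˡ f sA) sB
      (λ s₁ s₂ s₃ s₄ e → h s₁ s₂ (λ u → ∩ᵇ-⊆ A′ f u ∘ s₃ u) s₄
        (λ u v a b → trans (cong (λ c → if c then _ else _) (∩ᵇ-true A′ f u (s₃ u a))) (e u v a b))) qr
Leaves-restrict (bob g l r) {B′ = B′} sA sB h (ql , qr) =
    Leaves-restrict l sA (∩ᵇ-monoˡ (not ∘ g) sB)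
      (λ s₁ s₂ s₃ s₄ e → h s₁ s₂ s₃ (λ v → ∩ᵇ-⊆ B′ (not ∘ g) v ∘ s₄ v)
        (λ u v a b → trans (cong (λ c → if c then _ else _) (∖ᵇ-false B′ g v (s₄ v b))) (e u v a b))) ql
  , Leaves-restrict r sA (∩ᵇ-monoˡ g sB)
      (λ s₁ s₂ s₃ s₄ e → h s₁ s₂ s₃ (λ v → ∩ᵇ-⊆ B′ g v ∘ s₄ v)
        (λ u v a b → trans (cong (λ c → if c then _ else _) (∩ᵇ-true B′ g v (s₄ v b))) (e u v a b))) qr

Leaves-map : ∀ {X Y Z} {Q Q′ : RectPred X Y Z} π {A B} →
  (∀ {A B z} → Q A B z → Q′ A B z) → Leaves Q A B π → Leaves Q′ A B π
Leaves-map (output z)    h q         = h q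
Leaves-map (alice f l r) h (ql , qr) = Leaves-map l h ql , Leaves-map r h qr
Leaves-map (bob g l r)   h (ql , qr) = Leaves-map l h ql , Leaves-map r h qr

-- Restriction of a vacuous predicate: what remains is the knowledge of where each leaf rectangle
-- lies and what the run outputs on it.
Leaves-run : ∀ {X Y Z} {Q : RectPred X Y Z} π {A B} →
  (∀ {A₁ B₁ z} → A₁ ⊆ᵇ A → B₁ ⊆ᵇ B →
   (∀ u v → T (A₁ u) → T (B₁ v) → run π u v ≡ z) → Q A₁ B₁ z) →
  Leaves Q A B π
Leaves-run π h =
  Leaves-restrict π (λ _ → id) (λ _ → id) (λ _ _ sA sB e _ → h sA sB e) (trivial π)
  where
  trivial : ∀ {X Y Z} (π : CommTree X Y Z) {A B} → Leaves (λ _ _ _ → ⊤) A B π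
  trivial (output z)    = tt
  trivial (alice f l r) = trivial l , trivial r
  trivial (bob g l r)   = trivial l , trivial r

-- The cost recursion at an internal node, whose depth is `suc (a ⊔ b)` if its subtrees have depths
-- `a` and `b`.
2^⊔ : ∀ a b m → 2 ^ a * m + 2 ^ b * m ≤ 2 ^ suc (a ⊔ b) * m
2^⊔ a b m = begin
  2 ^ a * m + 2 ^ b * m
    ≤⟨ +-mono-≤ (*-monoˡ-≤ m (^-monoʳ-≤ 2 (m≤m⊔n a b))) (*-monoˡ-≤ m (^-monoʳ-≤ 2 (m≤n⊔m a b))) ⟩
  2 ^ (a ⊔ b) * m + 2 ^ (a ⊔ b) * m
    ≡⟨ *-distribʳ-+ m (2 ^ (a ⊔ b)) _ ⟨
  (2 ^ (a ⊔ b) + 2 ^ (a ⊔ b)) * m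
    ≡⟨ cong (λ c → (2 ^ (a ⊔ b) + c) * m) (+-identityʳ _) ⟨
  2 ^ suc (a ⊔ b) * m
    ∎
  where open ≤-Reasoning

-- Monotone separators from communication trees.

module Separation {n e : ℕ} (U V : CubeSet n) (Uᵣ Vᵣ : Fin e → CubeSet n) where

  Admissible : (Fin e → Cube n → Bool) → Set
  Admissible f = (∀ j u → u ∈ Uᵣ j → f j u ≡ true) × (∀ j v → v ∈ Vᵣ j → f j v ≡ false)

  Separates : Valuation n e → (Elem U → Bool) → (Elem V → Bool) → Set
  Separates h A B = ∀ f → Admissible f →
    (∀ u → T (A u) → h (value u) (λ j → f j (value u)) ≡ true) ×
    (∀ v → T (B v) → h (value v) (λ j → f j (value v)) ≡ false)

  Separates-cong : ∀ {h h′ A B} → (∀ x y → h x y ≡ h′ x y) → Separates h A B → Separates h′ A B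
  Separates-cong eq s f adm = let (p , q) = s f adm in
    (λ u a → trans (sym (eq _ _)) (p u a)) , (λ v b → trans (sym (eq _ _)) (q v b))

  Separates-⊆ : ∀ {h A A′ B B′} → A′ ⊆ᵇ A → B′ ⊆ᵇ B → Separates h A B → Separates h A′ B′
  Separates-⊆ sA sB s f adm = let (p , q) = s f adm in
    (λ u → p u ∘ sA u) , (λ v → q v ∘ sB v)

  record Separator {k} (gs : Gates n e k) (w : ℕ) (A : Elem U → Bool) (B : Elem V → Bool) : Set where
    field
      formula   : Formula n e k
      weight≤   : weight formula ≤ w
      separates : Separates (formulaValue gs formula) A B
  open Separator

  Separator-≤ : ∀ {k} {gs : Gates n e k} {w w′ A B} → w ≤ w′ → Separator gs w A B → Separator gs w′ A B
  Separator-≤ w≤w′ s = record { formula = formula s ; weight≤ = ≤-trans (weight≤ s) w≤w′ ; separates = separates s }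

  -- A point of `A` falls into one of the halves and makes that disjunct true; on `B` both disjuncts
  -- are false.
  alice-separator : ∀ {k} {gs : Gates n e k} {w w′ A B} (f : Elem U → Bool) →
    Separator gs w (A ∖ᵇ f) B → Separator gs w′ (A ∩ᵇ f) B → Separator gs (w + w′) A B
  alice-separator {gs = gs} {A = A} f s s′ = record
    { formula   = formula s ∨ᶠ formula s′
    ; weight≤   = +-mono-≤ (weight≤ s) (weight≤ s′)
    ; separates = λ g adm → let (p , q) = separates s g adm ; (p′ , q′) = separates s′ g adm in
        (λ u a → ∨-true (Sum.map (p u) (p′ u) (∈∖∪∩ A f u a))) , (λ v b → cong₂ _∨_ (q v b) (q′ v b))
    }

  -- Dually, a point of `B` makes one conjunct false, and both are true on `A`.
  bob-separator : ∀ {k} {gs : Gates n e k} {w w′ A B} (f : Elem V → Bool) →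
    Separator gs w A (B ∖ᵇ f) → Separator gs w′ A (B ∩ᵇ f) → Separator gs (w + w′) A B
  bob-separator {gs = gs} {B = B} f s s′ = record
    { formula   = formula s ∧ᶠ formula s′
    ; weight≤   = +-mono-≤ (weight≤ s) (weight≤ s′)
    ; separates = λ g adm → let (p , q) = separates s g adm ; (p′ , q′) = separates s′ g adm in
        (λ u a → cong₂ _∧_ (p u a) (p′ u a)) , (λ v b → ∧-false (Sum.map (q v) (q′ v) (∈∖∪∩ B f v b)))
    }

  tree-separator : ∀ {Z k} {gs : Gates n e k} {w} (π : CommTree (Elem U) (Elem V) Z) {A B} →
    Leaves (λ A B _ → Separator gs w A B) A B π → Separator gs (2 ^ bits π * w) A B
  tree-separator (output z) s = Separator-≤ (≤-reflexive (sym (*-identityˡ _))) s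
  tree-separator {w = w} (alice f l r) (sl , sr) =
    Separator-≤ (2^⊔ (bits l) (bits r) w) (alice-separator f (tree-separator l sl) (tree-separator r sr))
  tree-separator {w = w} (bob g l r) (sl , sr) =
    Separator-≤ (2^⊔ (bits l) (bits r) w) (bob-separator g (tree-separator l sl) (tree-separator r sr))

  -- Vacuous at rejecting leaves; oracles take care of those where the node is used.
  Realised : ∀ {k} → Gates n e k → RectPred (Elem U) (Elem V) Bool
  Realised gs A B z = T z → ∃[ i ] Separates (gateValue gs i) A B

  Realised-⊑ : ∀ {k k′} {gs : Gates n e k} {gs′ : Gates n e k′} → gs ⊑ gs′ →
               ∀ {A B z} → Realised gs A B z → Realised gs′ A B z
  Realised-⊑ p r z = let (i , s) = r z in
    embed p i , Separates-cong (λ x y → sym (gateValue-embed p i x y)) s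

  record Realisation {k} (gs : Gates n e k) (w : ℕ) A B (π : CommTree (Elem U) (Elem V) Bool) : Set where
    field
      {size}   : ℕ
      gates    : Gates n e size
      ext      : gs ⊑ gates
      bound    : size ≤ k + w
      realised : Leaves (Realised gates) A B π

  private
    realise-seq : ∀ {k} {gs : Gates n e k} {w w′ A B π A′ B′ π′}
                  (R : Realisation gs w A B π) → Realisation (Realisation.gates R) w′ A′ B′ π′ →
                  Σ[ m ∈ ℕ ] Σ[ hs ∈ Gates n e m ] gs ⊑ hs × m ≤ k + (w + w′) ×
                    Leaves (Realised hs) A B π × Leaves (Realised hs) A′ B′ π′
    realise-seq {k} {w = w} {w′} {π = π} R R′ =
      _ , R′.gates , ⊑-trans R.ext R′.ext ,
      ≤-trans R′.bound (≤-trans (+-monoˡ-≤ w′ R.bound) (≤-reflexive (+-assoc k w w′))) ,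
      Leaves-map π (λ {A} {B} {z} → Realised-⊑ R′.ext {A} {B} {z}) R.realised , R′.realised
      where
      module R  = Realisation R
      module R′ = Realisation R′

  -- The formulas of all accepting leaves are written over the fixed `gs` and compiled one after
  -- another into the growing `gs′`; each becomes a single gate for later use.
  realise : ∀ {k k′} {gs : Gates n e k} {gs′ : Gates n e k′} {w} π {A B} →
    Leaves (λ A B z → T z → Separator gs w A B) A B π → gs ⊑ gs′ →
    Realisation gs′ (2 ^ bits π * w) A B π
  realise {gs′ = gs′} (output false) s p = record
    { gates = gs′ ; ext = ⊑-refl ; bound = m≤m+n _ _ ; realised = λ () }
  realise {k′ = k′} {w = w} (output true) s p = record
    { gates    = gates
    ; ext      = ext
    ; bound    = ≤-trans (n≤1+n _) (≤-trans bound (+-monoʳ-≤ k′ (≤-trans (weight≤ (s tt)) (≤-reflexive (sym (*-identityˡ w))))))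
    ; realised = λ _ → out , Separates-cong (λ x y → sym (correct x y)) (separates (s tt))
    }
    where open Compiled (compile (formula (s tt)) p)
  realise {k′ = k′} {w = w} (alice f l r) (sl , sr) p
    with R ← realise l sl p
    with m , hs , q , b , rl , rr ← realise-seq R (realise r sr (⊑-trans p (Realisation.ext R)))
    = record { gates = hs ; ext = q ; bound = ≤-trans b (+-monoʳ-≤ k′ (2^⊔ (bits l) (bits r) w)) ; realised = rl , rr }
  realise {k′ = k′} {w = w} (bob g l r) (sl , sr) p
    with R ← realise l sl p
    with m , hs , q , b , rl , rr ← realise-seq R (realise r sr (⊑-trans p (Realisation.ext R)))
    = record { gates = hs ; ext = q ; bound = ≤-trans b (+-monoʳ-≤ k′ (2^⊔ (bits l) (bits r) w)) ; realised = rl , rr }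

  -- The circuit, built along the graph of the protocol.

  module FromProtocol
    (Pr : Protocol (Elem U) (Elem V) (Fin n)) (t : ℕ) (cc : Protocol.CC≤ Pr t)
    (rectangle : (A : Elem U → Bool) (B : Elem V → Bool) →
      ((u : Elem U) (v : Elem V) → T (A u) → T (B v) → Protocol.Error Pr (KWᵐ U V) u v) →
      Σ[ j ∈ Fin e ] ((u : Elem U) → T (A u) → value u ∈ Uᵣ j) × ((v : Elem V) → T (B v) → value v ∈ Vᵣ j))
    where

    open Protocol Pr hiding (size; CC≤)
    open Protocol Pr using () renaming (size to order)

    F-tree : Node → CommTree (Elem U) (Elem V) Bool
    F-tree x = proj₁ (proj₁ (cc x))

    F-tree-bits : ∀ x → bits (F-tree x) ≤ t
    F-tree-bits x = proj₁ (proj₂ (proj₁ (cc x)))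

    F-tree-run : ∀ x u v → run (F-tree x) u v ≡ F u v x
    F-tree-run x = proj₂ (proj₂ (proj₁ (cc x)))

    -- Stated for the full rectangle, so that the gates of a node serve every predecessor, whatever
    -- subrectangle arrives from it.
    Separable : ∀ {k} → Gates n e k → Node → Set
    Separable gs x = Leaves (Realised gs) full full (F-tree x)

    -- The values of an admissible `f j` are prescribed on `A` and `B`, whose points lie in `Uᵣ j`
    -- and `Vᵣ j`. An atom has weight 2.
    oracle-separator : ∀ {k} {gs : Gates n e k} {A B} →
      (∀ u v → T (A u) → T (B v) → Error (KWᵐ U V) u v) → Separator gs 2 A B
    oracle-separator {A = A} {B} err = let (j , p , q) = rectangle A B err in record
      { formula   = oracle j
      ; weight≤   = ≤-refl
      ; separates = λ f adm → (λ u a → proj₁ adm j (value u) (p u a)) , (λ v b → proj₂ adm j (value v) (q v b))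
      }

    -- One factor `2 ^ t` is for the tree of `S`, the other for the tree of `F` at the successor.
    -- The 8 is the price at a protocol leaf: a tree of depth two over atoms of weight 2.
    cost : ℕ
    cost = 2 ^ t * (2 ^ t * 8)

    2^t*-mono : ∀ {d m m′} → d ≤ t → m ≤ m′ → 2 ^ d * m ≤ 2 ^ t * m′
    2^t*-mono d≤t m≤m′ = *-mono-≤ (^-monoʳ-≤ 2 d≤t) m≤m′

    leaf-separator : ∀ {k} {gs : Gates n e k} {A B} x → Leaf x →
      (∀ u v → T (A u) → T (B v) → T (F u v x)) → Separator gs cost A B
    leaf-separator {gs = gs} {A} {B} x l inF =
      Separator-≤ (2^t*-mono (z≤n {t}) (2^t*-mono (z≤n {t}) ≤-refl)) $
      -- With i the label of `x`, the first player reveals u_i and, if it is 1, the second reveals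
      -- v_i. Of the three leaves only the middle one, u_i = 1 and v_i = 0, is free of label errors.
      tree-separator (alice f (output tt) (bob g (output tt) (output tt)))
        ( Separator-≤ ≤-refl (oracle-separator λ u v a b →
            inj₂ (x , l , inF u v (∩ᵇ-⊆ A (not ∘ f) u a) b , λ (p , _) → true≢false (trans (sym p) (∖ᵇ-false A f u a))))
        , input-separator
        , oracle-separator λ u v a b →
            inj₂ (x , l , inF u v (∩ᵇ-⊆ A f u a) (∩ᵇ-⊆ B g v b) , λ (_ , q) → true≢false (trans (sym (∩ᵇ-true B g v b)) q))
        )
      where
      f : Elem U → Bool
      f u = lookup (value u) (lab x l)
      g : Elem V → Bool
      g v = lookup (value v) (lab x l)
      true≢false : ¬ true ≡ false
      true≢false ()
      input-separator : Separator gs 2 (A ∩ᵇ f) (B ∖ᵇ g)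
      input-separator = record
        { formula = input (lab x l) ; weight≤ = ≤-refl ; separates = λ _ _ → ∩ᵇ-true A f , ∖ᵇ-false B g }

    -- A rejecting leaf of the tree for y is a rectangle of step errors.
    use-separable : ∀ {k} {gs : Gates n e k} {A B} y → Separable gs y →
      (∀ u v → T (A u) → T (B v) → ¬ T (F u v y) → Error (KWᵐ U V) u v) → Separator gs (2 ^ t * 2) A B
    use-separable {gs = gs} y sep err =
      Separator-≤ (2^t*-mono (F-tree-bits y) ≤-refl) $ tree-separator (F-tree y) $
      Leaves-restrict (F-tree y) (λ _ _ → tt) (λ _ _ → tt) at-leaf sep
      where
      at-leaf : ∀ {A₁ A₁′ B₁ B₁′ z} → A₁′ ⊆ᵇ A₁ → B₁′ ⊆ᵇ B₁ → A₁′ ⊆ᵇ _ → B₁′ ⊆ᵇ _ →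
        (∀ u v → T (A₁′ u) → T (B₁′ v) → run (F-tree y) u v ≡ z) → Realised gs A₁ B₁ z → Separator gs 2 A₁′ B₁′
      at-leaf {z = true}  sA sB _ _ _ r = let (i , s) = r tt in
        record { formula = node i ; weight≤ = ≤-refl ; separates = Separates-⊆ {gateValue gs i} sA sB s }
      at-leaf {z = false} _ _ tA tB e _ = oracle-separator λ u v a b →
        err u v (tA u a) (tB v b) λ inF → subst T (trans (sym (F-tree-run y u v)) (e u v a b)) inF

    -- Once `S` has fixed the successor `y`, every pair with `y` outside `F` is a step error, so
    -- `use-separable` applies at each leaf of the tree for `S`.
    inner-separator : ∀ {k} {gs : Gates n e k} {A B} (P : Subset order) (sep : ∀ y → y Subset.∈ P → Separable gs y) →
      ∀ x → ¬ Leaf x → (∀ y → Edge x y → y Subset.∈ P) →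
      (∀ u v → T (A u) → T (B v) → T (F u v x)) → Separator gs cost A B
    inner-separator {gs = gs} {A} {B} P sep x nl succ inF =
      -- Innermost weight 2 instead of the 8 allowed by `cost`.
      Separator-≤ (2^t*-mono S-bits (*-monoʳ-≤ (2 ^ t) (s≤s (s≤s z≤n)))) $
      tree-separator S-tree $ Leaves-run S-tree at-leaf
      where
      S-tree : CommTree (Elem U) (Elem V) Node
      S-tree = proj₁ (proj₂ (cc x) nl)
      S-bits : bits S-tree ≤ t
      S-bits = proj₁ (proj₂ (proj₂ (cc x) nl))
      S-run : ∀ u v → run S-tree u v ≡ S u v x nl
      S-run = proj₂ (proj₂ (proj₂ (cc x) nl))
      at-leaf : ∀ {A₁ B₁ y} → A₁ ⊆ᵇ A → B₁ ⊆ᵇ B →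
        (∀ u v → T (A₁ u) → T (B₁ v) → run S-tree u v ≡ y) → Separator gs (2 ^ t * 2) A₁ B₁
      at-leaf {y = y} sA sB e with y ∈? P
      ... | yes y∈P = use-separable y (sep y y∈P) λ u v a b ¬Fy →
        inj₁ (x , nl , inF u v (sA u a) (sB v b) , ¬Fy ∘ subst (T ∘ F u v) (trans (sym (S-run u v)) (e u v a b)))
      -- The rectangle is empty, since S always follows an edge.
      ... | no  y∉P = Separator-≤ (2^t*-mono (z≤n {t}) ≤-refl) $ oracle-separator λ u v a b →
        contradiction (succ y (subst (Edge x) (trans (sym (S-run u v)) (e u v a b)) (S-edge u v x nl))) y∉P

    node-separator : ∀ {k} {gs : Gates n e k} {A B} (P : Subset order) (sep : ∀ y → y Subset.∈ P → Separable gs y) →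
      ∀ x → (∀ y → Edge x y → y Subset.∈ P) →
      (∀ u v → T (A u) → T (B v) → T (F u v x)) → Separator gs cost A B
    node-separator P sep x succ inF with leaf? x
    ... | yes l = leaf-separator x l inF
    ... | no nl = inner-separator P sep x nl succ inF

    -- The bound charges each processed node for up to `2 ^ t` accepting leaves, each adding at most
    -- `cost` gates.
    record Partial (P : Subset order) : Set where
      field
        {size}    : ℕ
        gates     : Gates n e size
        bound     : size ≤ ∣ P ∣ * (2 ^ t * cost)
        separable : ∀ x → x Subset.∈ P → Separable gates x

    -- The strict inclusion serves twice: it raises the cardinality in the size bound and makes
    -- `reach-root` terminate.
    add-node : ∀ {P} x → ¬ (x Subset.∈ P) → (∀ y → Edge x y → y Subset.∈ P) → Partial P →
      (P Subset.⊂ P ∪ ⁅ x ⁆) × Partial (P ∪ ⁅ x ⁆)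
    add-node {P} x x∉P succ part = P⊂P∪x , record
      { gates     = R.gates
      ; bound     = begin
          R.size                                               ≤⟨ R.bound ⟩
          S.size + 2 ^ bits (F-tree x) * cost                  ≤⟨ +-mono-≤ S.bound (2^t*-mono (F-tree-bits x) ≤-refl) ⟩
          ∣ P ∣ * (2 ^ t * cost) + 2 ^ t * cost                ≡⟨ +-comm _ (2 ^ t * cost) ⟩
          suc ∣ P ∣ * (2 ^ t * cost)                           ≤⟨ *-monoˡ-≤ (2 ^ t * cost) (p⊂q⇒∣p∣<∣q∣ P⊂P∪x) ⟩
          ∣ P ∪ ⁅ x ⁆ ∣ * (2 ^ t * cost)                       ∎
      ; separable = λ y y∈ → separable y (x∈p∪q⁻ P ⁅ x ⁆ y∈)
      }
      where
      open ≤-Reasoning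
      module S = Partial part
      module R = Realisation (realise {gs = S.gates} (F-tree x)
        -- At an accepting leaf, correctness of the tree puts the whole leaf rectangle into `F` at
        -- `x`.
        (Leaves-run (F-tree x) λ _ _ e z → node-separator P S.separable x succ λ u v a b →
          subst T (trans (sym (e u v a b)) (F-tree-run x u v)) z)
        ⊑-refl)
      P⊂P∪x : P Subset.⊂ P ∪ ⁅ x ⁆
      P⊂P∪x = p⊆p∪q ⁅ x ⁆ , x , q⊆p∪q P ⁅ x ⁆ (x∈⁅x⁆ x) , x∉P
      separable : ∀ y → y Subset.∈ P ⊎ y Subset.∈ ⁅ x ⁆ → Separable R.gates y
      separable y (inj₁ y∈P) = Leaves-map (F-tree y) (λ {A} {B} {z} → Realised-⊑ R.ext {A} {B} {z}) (S.separable y y∈P)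
      separable y (inj₂ y∈x) with refl ← x∈⁅y⁆⇒x≡y x y∈x = R.realised

    -- By acyclicity the transitive closure of `Edge` is a strict order, and on a finite set it has
    -- no infinite ascending chain.
    edge-noetherian : WellFounded (flip Edge)
    edge-noetherian = Subrelation.wellFounded Plus.[_] (spo-noetherian record
      { isEquivalence = isEquivalence
      ; irrefl        = λ { refl → acyclic _ }
      ; trans         = Plus._++_
      ; <-resp-≈      = resp₂ (Plus.TransClosure Edge)
      })

    -- Moving along edges to missing nodes must stop, and it stops where all successors are present.
    -- Nodes are thus added in a reverse topological order.
    minimal-missing : ∀ (P : Subset order) x → Acc (flip Edge) x → ¬ (x Subset.∈ P) →
      ∃[ y ] ¬ (y Subset.∈ P) × (∀ z → Edge y z → z Subset.∈ P)
    minimal-missing P x (acc rec) x∉P with Fin.any? (λ y → T? (edge x y) ×-dec ¬? (y ∈? P))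
    ... | yes (y , x→y , y∉P) = minimal-missing P y (rec x→y) y∉P
    ... | no ¬∃ = x , x∉P , λ z x→z → decidable-stable (z ∈? P) λ z∉P → ¬∃ (z , x→z , z∉P)

    reach-root : ∀ P → Acc Subset._⊃_ P → Partial P → Σ[ P′ ∈ Subset order ] root Subset.∈ P′ × Partial P′
    reach-root P (acc rec) part with root ∈? P
    ... | yes r∈P = P , r∈P , part
    ... | no  r∉P =
      let (x , x∉P , succ) = minimal-missing P root (edge-noetherian root) r∉P
          (P⊂ , part′) = add-node x x∉P succ part
      in reach-root (P ∪ ⁅ x ⁆) (rec P⊂) part′

    separating-circuit : Σ[ D ∈ MonotoneCircuit n e ]
      MonotoneCircuit.size D ≤ order * (2 ^ t * cost) + 2 ^ t * 2 × Separates (MonotoneCircuit.eval D) full full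
    separating-circuit with P , r∈P , part ← reach-root Subset.⊥ (⊃-wellFounded _)
                              (record { gates = [] ; bound = z≤n ; separable = λ x x∈⊥ → ⊥-elim (∉⊥ x∈⊥) }) =
      record { size = C.size ; gates = C.gates ; out = C.out }
      , bound
      , Separates-cong (λ x y → sym (C.correct x y)) (separates sep)
      where
      module S = Partial part
      sep : Separator S.gates (2 ^ t * 2) full full
      -- The root is always in `F`, so the rejecting leaf rectangles of its tree are empty. This
      -- last formula, joining the gates of the root, accounts for the summand `2 ^ t * 2`.
      sep = use-separable root (S.separable root r∈P) λ u v _ _ ¬Fr → contradiction (root∈F u v) ¬Fr
      module C = Compiled (compile (formula sep) (⊑-refl {gs = S.gates}))
      bound : C.size ≤ order * (2 ^ t * cost) + 2 ^ t * 2
      bound = ≤-trans (n≤1+n _) (≤-trans C.bound (+-mono-≤ (≤-trans S.bound (*-monoˡ-≤ (2 ^ t * cost) (∣p∣≤n P))) (weight≤ sep)))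

-- Enumeration of subsets of the cube and the oracle rectangles.

T-does : {P : Set} (P? : Dec P) → T (does P?) → P
T-does (yes p) _ = p

does-T : {P : Set} (P? : Dec P) → P → T (does P?)
does-T P? p = from T-≡ (dec-true P? p)

allCube-complete : ∀ {n} (x : Cube n) → x ∈ˡ allCube n
allCube-complete []          = Any.here refl
allCube-complete (false ∷ x) = ∈-++⁺ˡ (∈-map⁺ _ (allCube-complete x))
allCube-complete (true ∷ x)  = ∈-++⁺ʳ _ (∈-map⁺ _ (allCube-complete x))

∀cube? : ∀ {n} {P : Cube n → Set} → (∀ x → Dec (P x)) → Dec (∀ x → P x)
∀cube? {n} P? = map′ (λ ps x → All.lookup ps (allCube-complete x)) (λ p → All.tabulate λ {x} _ → p x) (All.all? P? (allCube n))

infixr 5 _∣_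
_∣_ : ∀ {n} → CubeSet n → CubeSet n → CubeSet (suc n)
(A ∣ B) (false ∷ x) = A x
(A ∣ B) (true ∷ x)  = B x

allCubeSet : ∀ n → List (CubeSet n)
allCubeSet zero    = (λ _ → false) ∷ (λ _ → true) ∷ []
allCubeSet (suc n) = cartesianProductWith _∣_ (allCubeSet n) (allCubeSet n)

-- Completeness is up to pointwise equality, as function extensionality is not available.
allCubeSet-complete : ∀ {n} (A : CubeSet n) → ∃[ A′ ] A′ ∈ˡ allCubeSet n × (∀ x → A′ x ≡ A x)
allCubeSet-complete {zero} A with A [] in eq
... | false = _ , Any.here refl , λ { [] → sym eq }
... | true  = _ , Any.there (Any.here refl) , λ { [] → sym eq }
allCubeSet-complete {suc n} A
  with A₀ , i₀ , e₀ ← allCubeSet-complete (A ∘ (false ∷_))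
  with A₁ , i₁ , e₁ ← allCubeSet-complete (A ∘ (true ∷_))
  = A₀ ∣ A₁ , ∈-cartesianProductWith⁺ _∣_ i₀ i₁ , λ { (false ∷ x) → e₀ x ; (true ∷ x) → e₁ x }

module Rectangles {n : ℕ} (U V : CubeSet n) {Bad : Cube n → Cube n → Set} (bad? : ∀ u v → Dec (Bad u v)) where

  BadRectangle : CubeSet n × CubeSet n → Set
  BadRectangle (A , B) = A ⊆ U × B ⊆ V × (∀ u v → u ∈ A → v ∈ B → Bad u v)

  badRectangle? : ∀ R → Dec (BadRectangle R)
  badRectangle? (A , B) =
    (∀cube? λ x → T? (A x) →-dec T? (U x)) ×-dec (∀cube? λ x → T? (B x) →-dec T? (V x)) ×-dec
    (∀cube? λ u → ∀cube? λ v → T? (A u) →-dec (T? (B v) →-dec bad? u v))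

  rectangles : List (CubeSet n × CubeSet n)
  rectangles = filter badRectangle? (cartesianProduct (allCubeSet n) (allCubeSet n))

  rectangles-bad : ∀ j → BadRectangle (List.lookup rectangles j)
  rectangles-bad j = proj₂ (∈-filter⁻ badRectangle? {xs = cartesianProduct (allCubeSet n) (allCubeSet n)} (∈-lookup j))

  -- The list holds a rectangle pointwise equal to `A` × `B`, and containment is what the oracles
  -- require.
  rectangles-complete : ∀ A B → BadRectangle (A , B) →
    Σ[ j ∈ Fin (length rectangles) ]
      A ⊆ proj₁ (List.lookup rectangles j) × B ⊆ proj₂ (List.lookup rectangles j)
  rectangles-complete A B (A⊆U , B⊆V , bad)
    with A′ , iA , eA ← allCubeSet-complete A
    with B′ , iB , eB ← allCubeSet-complete B
    = Any.index i , subst (λ R → A ⊆ proj₁ R × B ⊆ proj₂ R) (lookup-index i)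
        ((λ x → subst T (sym (eA x))) , (λ x → subst T (sym (eB x))))
    where
    i : (A′ , B′) ∈ˡ rectangles
    i = ∈-filter⁺ badRectangle? (∈-cartesianProduct⁺ iA iB)
          ( (λ x → A⊆U x ∘ subst T (eA x))
          , (λ x → B⊆V x ∘ subst T (eB x))
          , (λ u v a b → bad u v (subst T (eA u) a) (subst T (eB v) b)) )

-- Extension by `false` outside `U`: protocol inputs are elements of `U`, while oracle rectangles
-- consist of subsets of the cube.
extend : ∀ {n} {U : CubeSet n} → (Elem U → Bool) → CubeSet n
extend {U = U} A x = does (Σ-dec (T? (U x)) λ p → T? (A (x , [ p ])))

extend⁺ : ∀ {n} {U : CubeSet n} (A : Elem U → Bool) u → T (A u) → value u ∈ extend A
-- The membership proof stored in an element is irrelevant; decidability restores it.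
extend⁺ {U = U} A (x , [ p ]) a = does-T (Σ-dec (T? (U x)) _) (recompute (T? (U x)) p , a)

extend⁻ : ∀ {n} {U : CubeSet n} (A : Elem U → Bool) x → x ∈ extend A → Σ[ p ∈ x ∈ U ] T (A (x , [ p ]))
extend⁻ {U = U} A x = T-does (Σ-dec (T? (U x)) _)

-- A circuit with a local oracle from a single protocol.

module _ {n : ℕ} (U V : CubeSet n) (Pr : Protocol (Elem U) (Elem V) (Fin n)) where
  open Protocol Pr using (Error; error?)

  -- Defined on the whole cube and false outside U × V, so that `countPairs` can count it.
  ErrorAt : Cube n → Cube n → Set
  ErrorAt u v = Σ[ p ∈ u ∈ U ] Σ[ q ∈ v ∈ V ] Error (KWᵐ U V) (u , [ p ]) (v , [ q ])

  errorAt? : ∀ u v → Dec (ErrorAt u v)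
  errorAt? u v = Σ-dec (T? (U u)) λ p → Σ-dec (T? (V v)) λ q → error? (KWᵐ? U V) (u , [ p ]) (v , [ q ])

  -- The third component will bound the locality by the error count; it holds because every oracle
  -- rectangle consists of errors.
  protocol⇒CLO : ∀ t → Protocol.CC≤ Pr t →
    Σ[ C ∈ MonotoneCLO U V ]
      MonotoneCLO.size C ≤ Protocol.size Pr * (2 ^ t * (2 ^ t * (2 ^ t * 8))) + 2 ^ t * 2 ×
      (∀ u v → T (MonotoneCLO.covered C u v) → ErrorAt u v)
  protocol⇒CLO t cc = record
    { e         = length rectangles
    ; D         = D
    ; Uᵣ        = Uᵣ
    ; Vᵣ        = Vᵣ
    ; Uᵣ⊆U      = Uᵣ⊆U
    ; Vᵣ⊆V      = Vᵣ⊆V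
    ; separates = λ f _ fU fV → let (p , q) = D-separates f (fU , fV) in
        (λ u u∈U → p (u , [ u∈U ]) tt) , (λ v v∈V → q (v , [ v∈V ]) tt)
    } , D-size , λ u v c → covered-bad u v (T-does (Fin.any? _) c)
    where
    open Rectangles U V errorAt?
    Uᵣ Vᵣ : Fin (length rectangles) → CubeSet n
    Uᵣ j = proj₁ (List.lookup rectangles j)
    Vᵣ j = proj₂ (List.lookup rectangles j)
    Uᵣ⊆U : ∀ j → Uᵣ j ⊆ U
    Uᵣ⊆U j = proj₁ (rectangles-bad j)
    Vᵣ⊆V : ∀ j → Vᵣ j ⊆ V
    Vᵣ⊆V j = proj₁ (proj₂ (rectangles-bad j))
    covered-bad : ∀ u v → ∃[ j ] T (Uᵣ j u ∧ Vᵣ j v) → ErrorAt u v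
    covered-bad u v (j , c) = let (a , b) = to T-∧ c in proj₂ (proj₂ (rectangles-bad j)) u v a b
    rectangle : ∀ A B → (∀ u v → T (A u) → T (B v) → Error (KWᵐ U V) u v) →
      Σ[ j ∈ Fin (length rectangles) ] (∀ u → T (A u) → value u ∈ Uᵣ j) × (∀ v → T (B v) → value v ∈ Vᵣ j)
    rectangle A B err =
      let (j , p , q) = rectangles-complete (extend A) (extend B)
            ( (λ x → proj₁ ∘ extend⁻ A x)
            , (λ x → proj₁ ∘ extend⁻ B x)
            , (λ u v a b → let (pu , a′) = extend⁻ A u a ; (pv , b′) = extend⁻ B v b in pu , pv , err _ _ a′ b′) )
      in j , (λ u → p (value u) ∘ extend⁺ A u) , (λ v → q (value v) ∘ extend⁺ B v)
    circuit = Separation.FromProtocol.separating-circuit U V Uᵣ Vᵣ Pr t cc rectangle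
    D = proj₁ circuit
    D-size = proj₁ (proj₂ circuit)
    D-separates = proj₂ (proj₂ circuit)

-- The size bound, the choice of an outcome and the conclusion.

count-mono : {A : Set} {p q : A → Bool} → (∀ x → T (p x) → T (q x)) → ∀ xs → count p xs ≤ count q xs
count-mono p⊆q xs = Sublist.length-mono-≤ (Sublist.filter⁺ _ _ (λ { refl → p⊆q _ }) (Sublist.⊆-refl {x = xs}))

-- Let b be `2 ^ (t ⊔ 1)`. As `1 ≤ m`, the last summand can be charged to the nodes as well, which
-- gives at most 16 b³ per node. Since 2 ≤ b, 16 is at most b⁴, whence the exponent 7.
size-bound : ∀ {m s} t → 1 ≤ m → m ≤ s →
  m * (2 ^ t * (2 ^ t * (2 ^ t * 8))) + 2 ^ t * 2 ≤ s * 2 ^ (7 * (t ⊔ 1))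
size-bound {m} {s} t 1≤m m≤s = begin
  m * (2 ^ t * (2 ^ t * (2 ^ t * 8))) + 2 ^ t * 2
    ≤⟨ +-monoʳ-≤ _ (≤-trans (≤-reflexive (sym (*-identityˡ _))) (*-monoˡ-≤ (2 ^ t * 2) 1≤m)) ⟩
  m * (2 ^ t * (2 ^ t * (2 ^ t * 8))) + m * (2 ^ t * 2)
    ≡⟨ *-distribˡ-+ m _ _ ⟨
  m * (2 ^ t * (2 ^ t * (2 ^ t * 8)) + 2 ^ t * 2)
    ≤⟨ *-mono-≤ m≤s (+-mono-≤ (*-mono-≤ a≤b (*-mono-≤ a≤b (*-monoˡ-≤ 8 a≤b))) (*-mono-≤ a≤b 2≤)) ⟩
  s * (b * (b * (b * 8)) + b * (b * (b * 8)))
    ≡⟨ cong (s *_) (*-distribˡ-+ b _ _) ⟨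
  s * (b * (b * (b * 8) + b * (b * 8)))
    ≡⟨ cong (λ c → s * (b * c)) (*-distribˡ-+ b _ _) ⟨
  s * (b * (b * (b * 8 + b * 8)))
    ≡⟨ cong (λ c → s * (b * (b * c))) (*-distribˡ-+ b 8 8) ⟨
  s * (b * (b * (b * 16)))
    ≤⟨ *-monoʳ-≤ s (*-monoʳ-≤ b (*-monoʳ-≤ b (*-monoʳ-≤ b (^-monoˡ-≤ 4 2≤b)))) ⟩
  s * b ^ 7
    ≡⟨ cong (s *_) (trans (^-*-assoc 2 (t ⊔ 1) 7) (cong (2 ^_) (*-comm (t ⊔ 1) 7))) ⟩
  s * 2 ^ (7 * (t ⊔ 1))
    ∎
  where
  open ≤-Reasoning
  b : ℕ
  b = 2 ^ (t ⊔ 1)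
  a≤b : 2 ^ t ≤ b
  a≤b = ^-monoʳ-≤ 2 (m≤m⊔n t 1)
  2≤b : 2 ≤ b
  2≤b = ^-monoʳ-≤ 2 (m≤n⊔m t 1)
  1≤b : 1 ≤ b
  1≤b = ≤-trans (s≤s z≤n) 2≤b
  2≤ : 2 ≤ b * (b * 8)
  2≤ = ≤-trans (s≤s (s≤s z≤n)) (*-mono-≤ 1≤b (*-monoˡ-≤ 8 1≤b))

module _ {a ℓ₁ ℓ₂} (K : OrderedField a ℓ₁ ℓ₂) {n : ℕ} (U V : CubeSet n) {ε : OrderedField.Carrier K}
         (𝐏 : RandomizedProtocol K (KWᵐ U V) (KWᵐ? U V) ε) where
  open OrderedField K using (fromℕ; sum) renaming (_≤_ to _≤ᴷ_; _*_ to _*ᴷ_)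
  open OrderedFieldProperties K
  open RandomizedProtocol 𝐏 renaming (weight to probability)

  errorCount : Fin outcomes → ℕ
  errorCount r = countPairs λ u v → does (errorAt? U V (P r) u v)

  -- Outside U × V the event is empty; inside it is the error event of the protocol. The indicator
  -- on the right is the form that `averaging` expects.
  sum-errorAt≤ε : ∀ u v → sum (λ r → [ does (errorAt? U V (P r) u v) ]· probability r) ≤ᴷ [ U u ∧ V v ]· ε
  sum-errorAt≤ε u v = sum-[]·-≤ probability (U u ∧ V v)
    (λ uv → let (u∈U , v∈V) = to T-∧ uv in ≤ᴷ.trans
      (≤ᴷ.reflexive (sum-[]·-cong probability λ r → does-⇔
        (mk⇔ (λ (_ , _ , err) → err) (λ err → u∈U , v∈V , err))
        (errorAt? U V (P r) u v) (Protocol.error? (P r) (KWᵐ? U V) (u , [ u∈U ]) (v , [ v∈V ]))))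
      (error (u , [ u∈U ]) (v , [ v∈V ])))
    (λ ¬uv r → dec-false (errorAt? U V (P r) u v) λ (u∈U , v∈V , _) → ¬uv (from T-∧ (u∈U , v∈V)))

  good-outcome : ∃[ r ] fromℕ (errorCount r) ≤ᴷ ε *ᴷ fromℕ (countPairs λ u v → U u ∧ V v)
  good-outcome = averaging probability (λ r (u , v) → does (errorAt? U V (P r) u v)) (λ (u , v) → U u ∧ V v) ε
    weight≥0 weight-1 (λ (u , v) → sum-errorAt≤ε u v) (cartesianProduct (allCube n) (allCube n))

rectangle-nonempty : ∀ {n} (U V : CubeSet n) → Nonempty U → Nonempty V → 1 ≤ countPairs (λ u v → U u ∧ V v)
rectangle-nonempty U V (u , u∈U) (v , v∈V) = ∈-length
  (∈-filter⁺ (λ (u , v) → T? (U u ∧ V v)) (∈-cartesianProduct⁺ (allCube-complete u) (allCube-complete v)) (from T-∧ (u∈U , v∈V)))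

lemma3p1 : ∀ {a ℓ₁ ℓ₂} →
    Σ[ c ∈ ℕ ]
    ((K : OrderedField a ℓ₁ ℓ₂) (n : ℕ) (U V : CubeSet n) →
    Disjoint U V → Nonempty U → Nonempty V →
    UpClosed U ⊎ DownClosed V →
    (ε : OrderedField.Carrier K) (s t : ℕ) →
    (𝐏 : RandomizedProtocol K (KWᵐ U V) (KWᵐ? U V) ε) →
    RandomizedProtocol.Size≤ 𝐏 s →
    RandomizedProtocol.CC≤ 𝐏 t →
    Σ[ C ∈ MonotoneCLO U V ]
    (MonotoneCLO.size C ≤ s * 2 ^ (c * (t ⊔ 1)) ×
    OrderedField._≤_ K (MonotoneCLO.locality C K) ε))
lemma3p1 = 7 , λ K n U V _ U≠∅ V≠∅ _ ε s t 𝐏 size≤ cc≤ →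
  let open OrderedFieldProperties K
      (r , few-errors)      = good-outcome K U V 𝐏
      Pr                    = RandomizedProtocol.P 𝐏 r
      (C , C-size , C-errs) = protocol⇒CLO U V Pr t (cc≤ r)
      covered≤errors        = count-mono (λ (u , v) → does-T (errorAt? U V Pr u v) ∘ C-errs u v)
                                         (cartesianProduct (allCube n) (allCube n))
  in C
   -- The root witnesses that the protocol has at least one node.
   , ≤-trans C-size (size-bound t (≤-trans (s≤s z≤n) (Fin.toℕ<n (Protocol.root Pr))) (size≤ r))
   -- Covered pairs are errors of the chosen outcome, and these number at most ε times the size of U
   -- × V, which is positive.
   , /-≤ (1≤fromℕ (rectangle-nonempty U V U≠∅ V≠∅)) (≤ᴷ.trans (fromℕ-mono covered≤errors) few-errors)
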